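{- Let $n, k$ be non-negative integers and let $G$ be a finite simple graph. If for every edge $e \in E(G)$ the graph $G - V(e)$ is $(n,k)$-extendable, then $G$ is $(n,k+1)$-extendable. Moreover, this hypothesis does not in general imply that $G$ is $(n,k+2)$-extendable, nor that $G$ is $(n+2,k)$-extendable (i.e., there exist graphs $G$ such that $G - V(e)$ is $(n,k)$-extendable for every $e\in E(G)$ but $G$ is not $(n,k+2)$-extendable, and there exist graphs $G$ such that $G-V(e)$ is $(n,k)$-extendable for every $e \in E(G)$ but $G$ is not $(n+2,k)$-extendable).
   Context: A $k$-matching is a matching with $k$ edges; a 1-factor is a perfect matching. For $S \subseteq V(G)$, $G - S$ is the subgraph induced on $V(G)\setminus S$; for an edge $e$, $V(e)$ is its set of endpoints. For non-negative integers $n,k$, a graph $H$ is $(n,k)$-extendable if $n + 2k \leq |V(H)| - 2$, $|V(H)| - n$ is even, and for every set $S$ of $n$ vertices of $H$, the graph $H - S$ contains a $k$-matching and every $k$-matching of $H - S$ can be extended to a 1-factor of $H - S$.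
   Formalization: The first claim is proved for graphs G with at least one edge: an edgeless graph satisfies the hypothesis vacuously but has no (k+1)-matching, so it is never (n,k+1)-extendable. -}

module Defs where

open import Level using (0ℓ)
open import Data.Nat using (ℕ; _+_; _*_; _∸_; _≤_)
open import Data.Nat.Divisibility using (_∣_)
open import Data.Fin using (Fin)
open import Data.Fin.Subset using (Subset; ⊤; ⁅_⁆; _─_; ∣_∣; _∈_; _⊆_)
open import Data.Product using (_×_; Σ; ∃; ∃-syntax; _,_)
open import Data.Sum using (_⊎_)
open import Data.List using (List; length; []; _∷_; _++_)
open import Data.List.Relation.Unary.All using (All)
open import Data.List.Relation.Unary.Any using (Any)
open import Data.List.Relation.Unary.Unique.Propositional using (Unique)
import Data.List.Membership.Propositional as L
open import Relation.Binary.PropositionalEquality using (_≡_)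
open import Relation.Nullary using (¬_)

record Graph (v : ℕ) : Set₁ where
  field
    Adj    : Fin v → Fin v → Set
    sym    : ∀ {x y} → Adj x y → Adj y x
    irrefl : ∀ {x} → ¬ Adj x x
open Graph public

Edge : ℕ → Set
Edge v = Fin v × Fin v

endpoints : ∀ {v} → List (Edge v) → List (Fin v)
endpoints [] = []
endpoints ((x , y) ∷ M) = x ∷ y ∷ endpoints M

SameEdge : ∀ {v} → Edge v → Edge v → Set
SameEdge (a , b) (c , d) = (a ≡ c × b ≡ d) ⊎ (a ≡ d × b ≡ c)

IsMatching : ∀ {v} → Graph v → Subset v → List (Edge v) → Set
IsMatching G W M =
  All (λ { (x , y) → Adj G x y × x ∈ W × y ∈ W }) M × Unique (endpoints M)

IsKMatching : ∀ {v} → Graph v → Subset v → ℕ → List (Edge v) → Set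
IsKMatching G W k M = IsMatching G W M × length M ≡ k

IsPerfectMatching : ∀ {v} → Graph v → Subset v → List (Edge v) → Set
IsPerfectMatching G W M = IsMatching G W M × (∀ x → x ∈ W → x L.∈ endpoints M)

Extends : ∀ {v} → List (Edge v) → List (Edge v) → Set
Extends M M' = All (λ e → Any (SameEdge e) M') M

-- The induced subgraph G[W] is (n,k)-extendable.
-- (n + 2k ≤ |W| - 2 is written n + 2k + 2 ≤ |W| to avoid truncated subtraction;
--  n ≤ |W| follows, so |W| ∸ n is the true difference.)
Extendable : ∀ {v} → Graph v → Subset v → ℕ → ℕ → Set
Extendable {v} G W n k =
  n + 2 * k + 2 ≤ ∣ W ∣ ×
  2 ∣ (∣ W ∣ ∸ n) ×
  (∀ (S : Subset v) → S ⊆ W → ∣ S ∣ ≡ n →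
     (∃[ M ] IsKMatching G (W ─ S) k M) ×
     (∀ M → IsKMatching G (W ─ S) k M →
        ∃[ M' ] (IsPerfectMatching G (W ─ S) M' × Extends M M')))

GExtendable : ∀ {v} → Graph v → ℕ → ℕ → Set
GExtendable G n k = Extendable G ⊤ n k

EdgeDeletedExtendable : ∀ {v} → Graph v → ℕ → ℕ → Set
EdgeDeletedExtendable G n k =
  ∀ x y → Adj G x y → Extendable G (⊤ ─ ⁅ x ⁆ ─ ⁅ y ⁆) n k

HasEdge : ∀ {v} → Graph v → Set
HasEdge {v} G = Σ (Fin v) λ x → Σ (Fin v) λ y → Adj G x y

{-# OPTIONS --safe #-}
module Submission where

-- If G has an edge, then it has one avoiding any n-set S, and an edge ab avoiding S reduces
-- (n,k+1)-matchings of G − S to (n,k)-matchings of G − a − b − S.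
--
-- Both negative statements use one graph: an apex joined to an independent set B of n+k+2
-- vertices, which is joined completely to a large clique. An edge, a k-matching and n further
-- vertices leave some vertex of B for the apex, because each edge meets B at most once; the rest
-- of B is then matched into the clique and the remaining clique vertices are paired up. But s
-- deleted vertices together with a j-matching can exhaust B, isolating the apex, when
-- s + j = n+k+2.

open import Defs
open import Data.Nat using (ℕ; zero; suc; _+_; _*_; _∸_; _≤_; _<_; z≤n; s≤s)
open import Data.Nat.Properties hiding (_≟_; suc-injective; 0≢1+n)
open import Data.Nat.Divisibility using (_∣_; divides; ∣m+n∣m⇒∣n; ∣m∣n⇒∣m+n; m∣m*n; ∣-refl)
open import Data.Nat.Tactic.RingSolver using (solve-∀)
open import Data.Fin using (Fin; zero; suc; _↑ˡ_; _↑ʳ_; splitAt)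
open import Data.Fin.Properties
  using (_≟_; suc-injective; 0≢1+n; ↑ˡ-injective; ↑ʳ-injective; splitAt-↑ˡ; splitAt-↑ʳ;
    join-splitAt)
open import Data.Fin.Subset
  using (Subset; inside; outside; ⊤; ⁅_⁆; _─_; _∩_; ∣_∣; _∈_; _∉_; _⊆_; Nonempty)
open import Data.Fin.Subset.Properties
  using (∣⊤∣≡n; ∈⊤; x∈⁅x⁆; x∈⁅y⁆⇒x≡y; x∈p∧x∉q⇒x∈p─q; p─q⊆p; p⊆q⇒∣p∣≤∣q∣; drop-∷-⊆; out⊆; s⊆s;
    nonempty?; _∈?_; ∣p∩q∣≤∣p∣; p∩q⊆q; x∈p∩q⁺)
open import Data.Vec as Vec using ([]; _∷_; here; there)
open import Data.Vec.Properties using (lookup⇒[]=; []=⇒lookup; lookup∘tabulate)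
open import Data.Product using (_×_; Σ; ∃-syntax; ∃₂; _,_; proj₁; proj₂; uncurry)
open import Data.Sum using (_⊎_; inj₁; inj₂; [_,_]′)
import Data.Unit as Unit
import Data.Empty as Empty
open import Data.List using (List; []; _∷_; _++_; length; map; filter; take; drop; tabulate; allFin)
open import Data.List.Properties
  using (length-++; length-map; length-tabulate; length-filter; length-take; length-drop;
    take++drop≡id)
open import Data.List.Relation.Unary.All as All using (All; []; _∷_)
import Data.List.Relation.Unary.All.Properties as All
open import Data.List.Relation.Unary.Any using (Any; here; there)
open import Data.List.Relation.Unary.AllPairs using ([]; _∷_)
open import Data.List.Relation.Unary.Unique.Propositional using (Unique)
import Data.List.Relation.Unary.Unique.Propositional.Properties as Unique
open import Data.List.Relation.Unary.Unique.Propositional.Properties using (Unique[x∷xs]⇒x∉xs)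
import Data.List.Membership.Propositional as L
import Data.List.Membership.DecPropositional as DecMembership
open import Data.List.Membership.Propositional.Properties
  using (∈-++⁺ˡ; ∈-++⁺ʳ; ∈-++⁻; ∈-∃++; ∈-map⁺; ∈-map⁻; ∈-filter⁺; ∈-filter⁻;
    ∈-tabulate⁺; ∈-tabulate⁻; ∈-allFin)
open import Data.List.Relation.Binary.Permutation.Propositional
  using (_↭_; ↭⇒↭ₛ; ↭-refl; ↭-sym; ↭-trans; prep)
open import Data.List.Relation.Binary.Permutation.Propositional.Properties
  using (∈-resp-↭; ↭-length; shift)
open import Data.List.Relation.Binary.Permutation.Setoid.Properties using (Unique-resp-↭)
open import Function using (_∘_)
open import Relation.Binary.PropositionalEquality
  using (_≡_; _≢_; refl; trans; cong; cong₂; subst; setoid; module ≡-Reasoning)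
  renaming (sym to ≡-sym)
open import Relation.Nullary using (¬_; Dec; yes; no; does; contradiction; ¬?)
open import Relation.Nullary.Decidable using (dec-true; dec-false)

-- Arithmetic and parity.

+-suc-suc : ∀ m l → 2 + m + l ≡ m + (2 + l)
+-suc-suc = solve-∀

-- Since a + c = 2a + (c ∸ a), the difference is even. Writing it as d + d fits the recursion of
-- `crossMatching`, which uses up two surplus vertices for each unit of d.
excess : ∀ {a c} → a ≤ c → 2 ∣ (a + c) → ∃[ d ] c ≡ a + (d + d)
excess {a} {c} a≤c 2∣a+c with ∣m+n∣m⇒∣n (subst (2 ∣_) split 2∣a+c) (m∣m*n a)
  where
  regroup : ∀ a e → a + (a + e) ≡ 2 * a + e
  regroup = solve-∀
  split : a + c ≡ 2 * a + (c ∸ a)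
  split = trans (cong (a +_) (≡-sym (m+[n∸m]≡n a≤c))) (regroup a (c ∸ a))
... | divides d eq = d , trans (≡-sym (m+[n∸m]≡n a≤c)) (cong (a +_) (trans eq (double d)))
  where
  double : ∀ d → d * 2 ≡ d + d
  double = solve-∀

-- Lists without repetition

module _ {A : Set} where

  -- Split ys around the head of xs and remove it; by uniqueness the tail of xs still lies in what
  -- is left. All later vertex counts rest on this.
  unique-⊆⇒length≤ : {xs ys : List A} → Unique xs → (∀ {u} → u L.∈ xs → u L.∈ ys) →
                     length xs ≤ length ys
  unique-⊆⇒length≤ {[]} _ _ = z≤n
  unique-⊆⇒length≤ {x ∷ xs} {ys} xxs!@(_ ∷ xs!) sub with ∈-∃++ (sub (here refl))
  ... | ls , rs , refl = ≤-trans (s≤s (unique-⊆⇒length≤ xs! sub′))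
                                 (≤-reflexive (≡-sym (↭-length (shift x ls rs))))
    where
    sub′ : ∀ {u} → u L.∈ xs → u L.∈ ls ++ rs
    sub′ u∈xs with ∈-resp-↭ (shift x ls rs) (sub (there u∈xs))
    ... | here refl = contradiction u∈xs (Unique[x∷xs]⇒x∉xs xxs!)
    ... | there u∈ = u∈

  ∈-++-disjoint : {xs ys : List A} {u : A} → Unique (xs ++ ys) → u L.∈ xs → u L.∈ ys → Empty.⊥
  ∈-++-disjoint {_ ∷ xs} u! (here refl) u∈ys = Unique[x∷xs]⇒x∉xs u! (∈-++⁺ʳ xs u∈ys)
  ∈-++-disjoint (_ ∷ u!) (there u∈xs) u∈ys = ∈-++-disjoint u! u∈xs u∈ys

  unique-++⁻ˡ : (xs : List A) {ys : List A} → Unique (xs ++ ys) → Unique xs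
  unique-++⁻ˡ [] _ = []
  unique-++⁻ˡ (x ∷ xs) (x∉ ∷ u!) = All.++⁻ˡ xs x∉ ∷ unique-++⁻ˡ xs u!

  ∈-take : (m : ℕ) {xs : List A} {u : A} → u L.∈ take m xs → u L.∈ xs
  ∈-take m {xs} u∈ = subst (_ L.∈_) (take++drop≡id m xs) (∈-++⁺ˡ u∈)

  ∈-drop : (m : ℕ) {xs : List A} {u : A} → u L.∈ drop m xs → u L.∈ xs
  ∈-drop m {xs} u∈ = subst (_ L.∈_) (take++drop≡id m xs) (∈-++⁺ʳ (take m xs) u∈)

  unique-∷ : {x : A} {xs : List A} → ¬ (x L.∈ xs) → Unique xs → Unique (x ∷ xs)
  unique-∷ x∉xs xs! = All.¬Any⇒All¬ _ x∉xs ∷ xs!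

module _ {v : ℕ} where

  _∈ˡ?_ : (u : Fin v) (xs : List (Fin v)) → Dec (u L.∈ xs)
  _∈ˡ?_ = DecMembership._∈?_ _≟_

  ∈-++⁺-dec : ∀ {u} xs {ys : List (Fin v)} → (¬ (u L.∈ xs) → u L.∈ ys) → u L.∈ xs ++ ys
  ∈-++⁺-dec {u} xs f with u ∈ˡ? xs
  ... | yes u∈xs = ∈-++⁺ˡ u∈xs
  ... | no  u∉xs = ∈-++⁺ʳ xs (f u∉xs)

  _∖_ : List (Fin v) → List (Fin v) → List (Fin v)
  xs ∖ ys = filter (λ u → ¬? (u ∈ˡ? ys)) xs

  ∈-∖⁺ : ∀ {u xs ys} → u L.∈ xs → ¬ (u L.∈ ys) → u L.∈ xs ∖ ys
  ∈-∖⁺ {ys = ys} = ∈-filter⁺ (λ u → ¬? (u ∈ˡ? ys))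

  ∈-∖⁻ : ∀ {u} xs ys → u L.∈ xs ∖ ys → u L.∈ xs × ¬ (u L.∈ ys)
  ∈-∖⁻ xs ys = ∈-filter⁻ (λ u → ¬? (u ∈ˡ? ys))

  unique-∖ : ∀ {xs} ys → Unique xs → Unique (xs ∖ ys)
  unique-∖ ys = Unique.filter⁺ (λ u → ¬? (u ∈ˡ? ys))

  length-∖ : ∀ {xs} ys → Unique xs → length xs ≤ length ys + length (xs ∖ ys)
  length-∖ {xs} ys xs! = ≤-trans
    (unique-⊆⇒length≤ xs! (λ u∈xs → ∈-++⁺-dec ys (λ u∉ys → ∈-∖⁺ u∈xs u∉ys)))
    (≤-reflexive (length-++ ys))

  -- The two lists partition `Fin v`, so their concatenation and `allFin v` contain each other
  -- without repetition. The additive form avoids truncated subtraction.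
  length-complement : {xs ys : List (Fin v)} → Unique xs → Unique ys →
                      (∀ {u} → u L.∈ xs → ¬ (u L.∈ ys)) → (∀ {u} → ¬ (u L.∈ ys) → u L.∈ xs) →
                      length xs + length ys ≡ v
  length-complement {xs} {ys} xs! ys! disj cover = begin
    length xs + length ys ≡⟨ +-comm (length xs) (length ys) ⟩
    length ys + length xs ≡⟨ length-++ ys ⟨
    length (ys ++ xs)     ≡⟨ ≤-antisym (unique-⊆⇒length≤ ys++xs! (λ _ → ∈-allFin _))
                               (unique-⊆⇒length≤ (Unique.allFin⁺ v) (λ _ → ∈-++⁺-dec ys cover)) ⟩
    length (allFin v)     ≡⟨ length-tabulate _ ⟩
    v                     ∎
    where
    open ≡-Reasoning
    ys++xs! : Unique (ys ++ xs)
    ys++xs! = Unique.++⁺ ys! xs! (λ (u∈ys , u∈xs) → disj u∈xs u∈ys)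

-- Subsets and lists

∈-─⁻ : ∀ {v} (p q : Subset v) {x} → x ∈ p ─ q → x ∉ q
∈-─⁻ (_ ∷ p) (outside ∷ q) (there x∈) (there x∈q) = ∈-─⁻ p q x∈ x∈q
∈-─⁻ (_ ∷ p) (inside ∷ q) (there x∈) (there x∈q) = ∈-─⁻ p q x∈ x∈q

-- Extendability speaks of subsets and matchings of lists; counting is done on lists, with this as
-- the bridge.
elements : ∀ {v} → Subset v → List (Fin v)
elements [] = []
elements (inside ∷ p) = zero ∷ map suc (elements p)
elements (outside ∷ p) = map suc (elements p)

length-elements : ∀ {v} (p : Subset v) → length (elements p) ≡ ∣ p ∣
length-elements [] = refl
length-elements (inside ∷ p) = cong suc (trans (length-map suc (elements p)) (length-elements p))
length-elements (outside ∷ p) = trans (length-map suc (elements p)) (length-elements p)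

∈-elements⁺ : ∀ {v} (p : Subset v) {x} → x ∈ p → x L.∈ elements p
∈-elements⁺ (inside ∷ p) here = here refl
∈-elements⁺ (inside ∷ p) (there x∈p) = there (∈-map⁺ suc (∈-elements⁺ p x∈p))
∈-elements⁺ (outside ∷ p) (there x∈p) = ∈-map⁺ suc (∈-elements⁺ p x∈p)

∈-elements⁻ : ∀ {v} (p : Subset v) {x} → x L.∈ elements p → x ∈ p
∈-elements⁻ (inside ∷ p) (here refl) = here
∈-elements⁻ (inside ∷ p) (there x∈) with ∈-map⁻ suc x∈
... | _ , y∈ , refl = there (∈-elements⁻ p y∈)
∈-elements⁻ (outside ∷ p) x∈ with ∈-map⁻ suc x∈
... | _ , y∈ , refl = there (∈-elements⁻ p y∈)

unique-elements : ∀ {v} (p : Subset v) → Unique (elements p)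
unique-elements [] = []
unique-elements (inside ∷ p) =
  unique-∷ (λ z∈ → 0≢1+n (proj₂ (proj₂ (∈-map⁻ suc z∈)))) (Unique.map⁺ suc-injective (unique-elements p))
unique-elements (outside ∷ p) = Unique.map⁺ suc-injective (unique-elements p)

fromList : ∀ {v} → List (Fin v) → Subset v
fromList xs = Vec.tabulate (λ u → does (u ∈ˡ? xs))

∈-fromList⁺ : ∀ {v} {xs : List (Fin v)} {u} → u L.∈ xs → u ∈ fromList xs
∈-fromList⁺ {xs = xs} {u} u∈xs = lookup⇒[]= u _ (trans (lookup∘tabulate _ u) (dec-true (u ∈ˡ? xs) u∈xs))

∈-fromList⁻ : ∀ {v} (xs : List (Fin v)) {u} → u ∈ fromList xs → u L.∈ xs
∈-fromList⁻ xs {u} u∈ with u ∈ˡ? xs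
... | yes u∈xs = u∈xs
... | no u∉xs = contradiction
      (trans (≡-sym (trans (lookup∘tabulate _ u) (dec-false (u ∈ˡ? xs) u∉xs))) ([]=⇒lookup u∈)) (λ ())

∣fromList∣ : ∀ {v} {xs : List (Fin v)} → Unique xs → ∣ fromList xs ∣ ≡ length xs
∣fromList∣ {xs = xs} xs! = trans (≡-sym (length-elements (fromList xs))) (≤-antisym
  (unique-⊆⇒length≤ (unique-elements (fromList xs)) (∈-fromList⁻ xs ∘ ∈-elements⁻ (fromList xs)))
  (unique-⊆⇒length≤ xs! (∈-elements⁺ (fromList xs) ∘ ∈-fromList⁺)))

∣p∣<∣q∣⇒nonempty : ∀ {v} (p q : Subset v) → ∣ p ∣ < ∣ q ∣ → Nonempty (q ─ p)
∣p∣<∣q∣⇒nonempty p q p<q with nonempty? (q ─ p)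
... | yes ne = ne
... | no empty = contradiction (p⊆q⇒∣p∣≤∣q∣ q⊆p) (<⇒≱ p<q)
  where
  q⊆p : q ⊆ p
  q⊆p {x} x∈q with x ∈? p
  ... | yes x∈p = x∈p
  ... | no x∉p = contradiction (x , x∈p∧x∉q⇒x∈p─q x∈q x∉p) empty

-- Serves to enlarge a set to the exact size that extendability asks for. Greedy: an optional
-- element is skipped as long as the remaining positions of q can still supply n elements.
interpolate : ∀ {v} (p q : Subset v) n → p ⊆ q → ∣ p ∣ ≤ n → n ≤ ∣ q ∣ →
              ∃[ s ] (p ⊆ s × s ⊆ q × ∣ s ∣ ≡ n)
interpolate [] [] n _ lo hi = [] , (λ ()) , (λ ()) , ≡-sym (n≤0⇒n≡0 hi)
interpolate (outside ∷ p) (outside ∷ q) n p⊆q lo hi with interpolate p q n (drop-∷-⊆ p⊆q) lo hi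
... | s , p⊆s , s⊆q , eq = outside ∷ s , s⊆s p⊆s , s⊆s s⊆q , eq
interpolate (inside ∷ p) (outside ∷ q) n p⊆q lo hi with p⊆q here
... | ()
interpolate (inside ∷ p) (inside ∷ q) (suc n) p⊆q (s≤s lo) (s≤s hi)
  with interpolate p q n (drop-∷-⊆ p⊆q) lo hi
... | s , p⊆s , s⊆q , eq = inside ∷ s , s⊆s p⊆s , s⊆s s⊆q , cong suc eq
interpolate (outside ∷ p) (inside ∷ q) n p⊆q lo hi with n ≤? ∣ q ∣
... | yes n≤q = let s , p⊆s , s⊆q , eq = interpolate p q n (drop-∷-⊆ p⊆q) lo n≤q in
                outside ∷ s , s⊆s p⊆s , out⊆ s⊆q , eq
-- Here n exceeds the size of the tail by exactly one, so all of the larger set must be taken.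
... | no n≰q = inside ∷ q , p⊆q , (λ x∈ → x∈) , ≤-antisym (≰⇒> n≰q) hi

∈-delete₂⁺ : ∀ {v} {x y u : Fin v} → u ≢ x → u ≢ y → u ∈ ⊤ ─ ⁅ x ⁆ ─ ⁅ y ⁆
∈-delete₂⁺ u≢x u≢y =
  x∈p∧x∉q⇒x∈p─q (x∈p∧x∉q⇒x∈p─q ∈⊤ (u≢x ∘ x∈⁅y⁆⇒x≡y _)) (u≢y ∘ x∈⁅y⁆⇒x≡y _)

∈-delete₂⁻ : ∀ {v} {x y u : Fin v} → u ∈ ⊤ ─ ⁅ x ⁆ ─ ⁅ y ⁆ → u ≢ x × u ≢ y
∈-delete₂⁻ {x = x} {y} u∈ =
  (λ { refl → ∈-─⁻ ⊤ ⁅ x ⁆ (p─q⊆p (⊤ ─ ⁅ x ⁆) ⁅ y ⁆ u∈) (x∈⁅x⁆ x) }) ,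
  (λ { refl → ∈-─⁻ (⊤ ─ ⁅ x ⁆) ⁅ y ⁆ u∈ (x∈⁅x⁆ y) })

∣delete₂∣ : ∀ {v} {x y : Fin v} → x ≢ y → ∣ ⊤ ─ ⁅ x ⁆ ─ ⁅ y ⁆ ∣ + 2 ≡ v
∣delete₂∣ {x = x} {y} x≢y = trans (cong (_+ 2) (≡-sym (length-elements W)))
  (length-complement (unique-elements W) ((x≢y ∷ []) ∷ [] ∷ []) disj cover)
  where
  W = ⊤ ─ ⁅ x ⁆ ─ ⁅ y ⁆
  disj : ∀ {u} → u L.∈ elements W → ¬ (u L.∈ x ∷ y ∷ [])
  disj u∈ (here refl) = proj₁ (∈-delete₂⁻ (∈-elements⁻ W u∈)) refl
  disj u∈ (there (here refl)) = proj₂ (∈-delete₂⁻ (∈-elements⁻ W u∈)) refl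
  cover : ∀ {u} → ¬ (u L.∈ x ∷ y ∷ []) → u L.∈ elements W
  cover u∉ = ∈-elements⁺ W (∈-delete₂⁺ (λ { refl → u∉ (here refl) }) (λ { refl → u∉ (there (here refl)) }))

-- Matchings

module _ {v : ℕ} where

  endpoints-++ : (M N : List (Edge v)) → endpoints (M ++ N) ≡ endpoints M ++ endpoints N
  endpoints-++ [] N = refl
  endpoints-++ ((x , y) ∷ M) N = cong (λ l → x ∷ y ∷ l) (endpoints-++ M N)

  length-endpoints : (M : List (Edge v)) → length (endpoints M) ≡ 2 * length M
  length-endpoints [] = refl
  length-endpoints (_ ∷ M) = trans (cong (2 +_) (length-endpoints M)) (≡-sym (*-suc 2 (length M)))

  -- Edges are stored as ordered pairs. Forgetting the orientation turns a matching into a symmetric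
  -- partner relation.
  Joins : List (Edge v) → Fin v → Fin v → Set
  Joins M x y = Any (SameEdge (x , y)) M

  joins-sym : ∀ {M x y} → Joins M x y → Joins M y x
  joins-sym (here (inj₁ (refl , refl))) = here (inj₂ (refl , refl))
  joins-sym (here (inj₂ (refl , refl))) = here (inj₁ (refl , refl))
  joins-sym (there j) = there (joins-sym j)

  joins⇒∈ : ∀ {M x y} → Joins M x y → x L.∈ endpoints M
  joins⇒∈ (here (inj₁ (refl , refl))) = here refl
  joins⇒∈ (here (inj₂ (refl , refl))) = there (here refl)
  joins⇒∈ (there j) = there (there (joins⇒∈ j))

  ∈⇒joins : ∀ M {x} → x L.∈ endpoints M → ∃[ y ] Joins M x y
  ∈⇒joins ((x , y) ∷ M) (here refl) = y , here (inj₁ (refl , refl))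
  ∈⇒joins ((x , y) ∷ M) (there (here refl)) = x , here (inj₂ (refl , refl))
  ∈⇒joins ((x , y) ∷ M) (there (there x∈)) = let z , j = ∈⇒joins M x∈ in z , there j

  -- Two different entries of M through x would repeat x among the endpoints. Partners are therefore
  -- unique, which is what later denies the apex a partner.
  joins-functional : ∀ {M x y z} → Unique (endpoints M) → Joins M x y → Joins M x z → y ≡ z
  joins-functional _ (here (inj₁ (refl , refl))) (here (inj₁ (refl , refl))) = refl
  joins-functional _ (here (inj₁ (refl , refl))) (here (inj₂ (refl , refl))) = refl
  joins-functional _ (here (inj₂ (refl , refl))) (here (inj₁ (refl , refl))) = refl
  joins-functional _ (here (inj₂ (refl , refl))) (here (inj₂ (refl , refl))) = refl
  joins-functional u! (here (inj₁ (refl , refl))) (there j) =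
    contradiction (there (joins⇒∈ j)) (Unique[x∷xs]⇒x∉xs u!)
  joins-functional (_ ∷ u!) (here (inj₂ (refl , refl))) (there j) =
    contradiction (joins⇒∈ j) (Unique[x∷xs]⇒x∉xs u!)
  joins-functional u! (there j) (here (inj₁ (refl , refl))) =
    contradiction (there (joins⇒∈ j)) (Unique[x∷xs]⇒x∉xs u!)
  joins-functional (_ ∷ u!) (there j) (here (inj₂ (refl , refl))) =
    contradiction (joins⇒∈ j) (Unique[x∷xs]⇒x∉xs u!)
  joins-functional (_ ∷ _ ∷ u!) (there j) (there j′) = joins-functional u! j j′

  joins-extends : ∀ {M M′ x y} → Extends M M′ → Joins M x y → Joins M′ x y
  joins-extends (e ∷ _) (here (inj₁ (refl , refl))) = e
  joins-extends (e ∷ _) (here (inj₂ (refl , refl))) = joins-sym e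
  joins-extends (_ ∷ es) (there j) = joins-extends es j

  extends-++ˡ : (M N : List (Edge v)) → Extends M (M ++ N)
  extends-++ˡ [] N = []
  extends-++ˡ (e ∷ M) N = here (inj₁ (refl , refl)) ∷ All.map there (extends-++ˡ M N)

module _ {v : ℕ} (G : Graph v) where

  -- Adjacency is checked edge by edge but containment endpoint by endpoint, because constructions
  -- control the list of endpoints as a whole.
  isMatching⁺ : ∀ {W M} → All (uncurry (Adj G)) M → (∀ {u} → u L.∈ endpoints M → u ∈ W) →
                Unique (endpoints M) → IsMatching G W M
  isMatching⁺ {W} adj sub u! = go adj sub , u!
    where
    go : ∀ {M} → All (uncurry (Adj G)) M → (∀ {u} → u L.∈ endpoints M → u ∈ W) →
         All (λ (x , y) → Adj G x y × x ∈ W × y ∈ W) M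
    go [] sub = []
    go (a ∷ as) sub = (a , sub (here refl) , sub (there (here refl))) ∷ go as (λ u∈ → sub (there (there u∈)))

  isMatching⇒adj : ∀ {W M} → IsMatching G W M → All (uncurry (Adj G)) M
  isMatching⇒adj (es , _) = All.map proj₁ es

  isMatching⇒⊆ : ∀ {W M} → IsMatching G W M → ∀ {u} → u L.∈ endpoints M → u ∈ W
  isMatching⇒⊆ ((e ∷ _) , _) (here refl) = proj₁ (proj₂ e)
  isMatching⇒⊆ ((e ∷ _) , _) (there (here refl)) = proj₂ (proj₂ e)
  isMatching⇒⊆ ((_ ∷ es) , _ ∷ _ ∷ u!) (there (there u∈)) = isMatching⇒⊆ (es , u!) u∈

  joins⇒adj : ∀ {M x y} → All (uncurry (Adj G)) M → Joins M x y → Adj G x y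
  joins⇒adj (a ∷ _) (here (inj₁ (refl , refl))) = a
  joins⇒adj (a ∷ _) (here (inj₂ (refl , refl))) = Graph.sym G a
  joins⇒adj (_ ∷ as) (there j) = joins⇒adj as j

  adj⇒≢ : ∀ {x y} → Adj G x y → x ≢ y
  adj⇒≢ a refl = irrefl G a

  -- With a and b deleted, N cannot meet the new edge. Together with `isMatching-tail` this passes
  -- between matchings of G - S through ab and matchings of G - a - b - S.
  isMatching-∷ : ∀ {S N a b} → Adj G a b → a ∉ S → b ∉ S →
                 IsMatching G (⊤ ─ ⁅ a ⁆ ─ ⁅ b ⁆ ─ S) N → IsMatching G (⊤ ─ S) ((a , b) ∷ N)
  isMatching-∷ {S} {N} {a} {b} a~b a∉S b∉S m = isMatching⁺ (a~b ∷ isMatching⇒adj m) sub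
    (unique-∷ a∉ (unique-∷ (λ b∈ → proj₂ (avoid b∈) refl) (proj₂ m)))
    where
    W = ⊤ ─ ⁅ a ⁆ ─ ⁅ b ⁆
    avoid : ∀ {u} → u L.∈ endpoints N → u ≢ a × u ≢ b
    avoid u∈ = ∈-delete₂⁻ (p─q⊆p W S (isMatching⇒⊆ m u∈))
    a∉ : ¬ (a L.∈ b ∷ endpoints N)
    a∉ (here a≡b) = adj⇒≢ a~b a≡b
    a∉ (there a∈) = proj₁ (avoid a∈) refl
    sub : ∀ {u} → u L.∈ endpoints ((a , b) ∷ N) → u ∈ ⊤ ─ S
    sub (here refl) = x∈p∧x∉q⇒x∈p─q ∈⊤ a∉S
    sub (there (here refl)) = x∈p∧x∉q⇒x∈p─q ∈⊤ b∉S
    sub (there (there u∈)) = x∈p∧x∉q⇒x∈p─q ∈⊤ (∈-─⁻ W S (isMatching⇒⊆ m u∈))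

  isMatching-tail : ∀ {S N a b} → IsMatching G (⊤ ─ S) ((a , b) ∷ N) →
                    IsMatching G (⊤ ─ ⁅ a ⁆ ─ ⁅ b ⁆ ─ S) N
  isMatching-tail {S} {N} {a} {b} m@(_ ∷ es , u!@(_ ∷ u!′@(_ ∷ u!″))) =
    isMatching⁺ (All.map proj₁ es) sub u!″
    where
    sub : ∀ {u} → u L.∈ endpoints N → u ∈ ⊤ ─ ⁅ a ⁆ ─ ⁅ b ⁆ ─ S
    sub u∈ = x∈p∧x∉q⇒x∈p─q
      (∈-delete₂⁺ (λ { refl → Unique[x∷xs]⇒x∉xs u! (there u∈) }) (λ { refl → Unique[x∷xs]⇒x∉xs u!′ u∈ }))
      (∈-─⁻ ⊤ S (isMatching⇒⊆ m (there (there u∈))))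

  isMatching-take : ∀ k {W M} → IsMatching G W M → IsMatching G W (take k M)
  isMatching-take k {W} {M} m = isMatching⁺ (All.take⁺ k (isMatching⇒adj m))
    (λ u∈ → isMatching⇒⊆ m (subst (_ L.∈_) split (∈-++⁺ˡ u∈)))
    (unique-++⁻ˡ (endpoints (take k M)) (subst Unique (≡-sym split) (proj₂ m)))
    where
    split : endpoints (take k M) ++ endpoints (drop k M) ≡ endpoints M
    split = trans (≡-sym (endpoints-++ (take k M) (drop k M))) (cong endpoints (take++drop≡id k M))

  ⊆-delete₂ : ∀ {a b} {S : Subset v} → a ∉ S → b ∉ S → S ⊆ ⊤ ─ ⁅ a ⁆ ─ ⁅ b ⁆
  ⊆-delete₂ a∉S b∉S u∈S = ∈-delete₂⁺ (λ { refl → a∉S u∈S }) (λ { refl → b∉S u∈S })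

  -- The positive statement: from (n,k) after deleting an edge to (n,k+1).

  module _ {n k : ℕ} (deleted : EdgeDeletedExtendable G n k) where

    -- Enlarging S ∖ {x, y} to an n-set avoiding x and y leaves a nonempty graph with a perfect
    -- matching, whose edges avoid S.
    edge-avoiding : HasEdge G → ∀ S → ∣ S ∣ ≡ n → ∃₂ λ a b → Adj G a b × a ∉ S × b ∉ S
    edge-avoiding (x , y , x~y) S ∣S∣≡n = z , proj₁ partner , joins⇒adj (isMatching⇒adj perfect) joined ,
        avoids z∈ , avoids (isMatching⇒⊆ perfect (joins⇒∈ (joins-sym {M = proj₁ extension} joined)))
      where
      W = ⊤ ─ ⁅ x ⁆ ─ ⁅ y ⁆
      bound = proj₁ (deleted x y x~y)
      -- The summand 2 in the size bound is what makes this strict, so that a vertex remains outside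
      -- the enlarged set.
      n<∣W∣ : n < ∣ W ∣
      n<∣W∣ = ≤-trans (≤-trans (≤-reflexive (+-comm 1 n)) (+-mono-≤ (m≤m+n n (2 * k)) (s≤s (z≤n {1})))) bound
      enlarged = interpolate (S ∩ W) W n (p∩q⊆q S W)
                   (≤-trans (∣p∩q∣≤∣p∣ S W) (≤-reflexive ∣S∣≡n)) (<⇒≤ n<∣W∣)
      S′ = proj₁ enlarged
      S∩W⊆S′ = proj₁ (proj₂ enlarged)
      S′⊆W = proj₁ (proj₂ (proj₂ enlarged))
      ∣S′∣≡n = proj₂ (proj₂ (proj₂ enlarged))
      avoids : ∀ {u} → u ∈ W ─ S′ → u ∉ S
      avoids u∈ u∈S = ∈-─⁻ W S′ u∈ (S∩W⊆S′ (x∈p∩q⁺ (u∈S , p─q⊆p W S′ u∈)))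
      matchings = proj₂ (proj₂ (deleted x y x~y)) S′ S′⊆W ∣S′∣≡n
      extension = proj₂ matchings (proj₁ (proj₁ matchings)) (proj₂ (proj₁ matchings))
      perfect = proj₁ (proj₁ (proj₂ extension))
      nonempty = ∣p∣<∣q∣⇒nonempty S′ W (≤-trans (s≤s (≤-reflexive ∣S′∣≡n)) n<∣W∣)
      z = proj₁ nonempty
      z∈ = proj₂ nonempty
      partner = ∈⇒joins (proj₁ extension) (proj₂ (proj₁ (proj₂ extension)) z z∈)
      joined = proj₂ partner

    -- Size and parity follow from one edge, whose two ends account for the increase. A
    -- (k+1)-matching arises by adding an edge avoiding S to a k-matching of the rest.
    gExtendable-suc : HasEdge G → GExtendable G n (suc k)
    gExtendable-suc edge@(x , y , x~y) = bound′ , even′ , λ S _ ∣S∣≡n → exists S ∣S∣≡n , extend S ∣S∣≡n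
      where
      W = ⊤ ─ ⁅ x ⁆ ─ ⁅ y ⁆
      bound = proj₁ (deleted x y x~y)
      ∣⊤∣≡ : ∣ ⊤ {v} ∣ ≡ ∣ W ∣ + 2
      ∣⊤∣≡ = trans (∣⊤∣≡n v) (≡-sym (∣delete₂∣ (adj⇒≢ x~y)))
      regroup : ∀ n k → n + 2 * suc k + 2 ≡ n + 2 * k + 2 + 2
      regroup = solve-∀
      bound′ : n + 2 * suc k + 2 ≤ ∣ ⊤ {v} ∣
      bound′ = subst (_ ≤_) (≡-sym ∣⊤∣≡) (subst (_≤ ∣ W ∣ + 2) (≡-sym (regroup n k)) (+-monoˡ-≤ 2 bound))
      n≤∣W∣ : n ≤ ∣ W ∣
      n≤∣W∣ = ≤-trans (≤-trans (m≤m+n n (2 * k)) (m≤m+n (n + 2 * k) 2)) bound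
      even′ : 2 ∣ (∣ ⊤ {v} ∣ ∸ n)
      even′ = subst (2 ∣_) (≡-sym (trans (cong (_∸ n) ∣⊤∣≡) (+-∸-comm 2 n≤∣W∣)))
                (∣m∣n⇒∣m+n (proj₁ (proj₂ (deleted x y x~y))) ∣-refl)
      exists : ∀ S → ∣ S ∣ ≡ n → ∃[ M ] IsKMatching G (⊤ ─ S) (suc k) M
      exists S ∣S∣≡n =
        let a , b , a~b , a∉S , b∉S = edge-avoiding edge S ∣S∣≡n
            (N , m , len) , _ = proj₂ (proj₂ (deleted a b a~b)) S (⊆-delete₂ a∉S b∉S) ∣S∣≡n
        in (a , b) ∷ N , isMatching-∷ a~b a∉S b∉S m , cong suc len
      extend : ∀ S → ∣ S ∣ ≡ n → ∀ M → IsKMatching G (⊤ ─ S) (suc k) M →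
               ∃[ M′ ] (IsPerfectMatching G (⊤ ─ S) M′ × Extends M M′)
      -- Having k + 1 edges, the matching has a first edge ab, and it avoids S; the hypothesis at ab
      -- extends the other k edges.
      extend S ∣S∣≡n ((a , b) ∷ N) (m@((a~b , a∈ , b∈) ∷ _ , _) , len) =
        let a∉S = ∈-─⁻ ⊤ S a∈
            b∉S = ∈-─⁻ ⊤ S b∈
            N′ , (m′ , covers) , ext = proj₂ (proj₂ (proj₂ (deleted a b a~b)) S (⊆-delete₂ a∉S b∉S) ∣S∣≡n)
                                   N (isMatching-tail m , cong Data.Nat.pred len)
        in (a , b) ∷ N′ , (isMatching-∷ a~b a∉S b∉S m′ , covers′ N′ covers) ,
           here (inj₁ (refl , refl)) ∷ All.map there ext
        where
        covers′ : ∀ N′ → (∀ u → u ∈ ⊤ ─ ⁅ a ⁆ ─ ⁅ b ⁆ ─ S → u L.∈ endpoints N′) →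
                  ∀ u → u ∈ ⊤ ─ S → u L.∈ endpoints ((a , b) ∷ N′)
        covers′ N′ covers u u∈ with u ≟ a | u ≟ b
        ... | yes u≡a | _ = here u≡a
        ... | no _ | yes u≡b = there (here u≡b)
        ... | no u≢a | no u≢b =
          there (there (covers u (x∈p∧x∉q⇒x∈p─q (∈-delete₂⁺ u≢a u≢b) (∈-─⁻ ⊤ S u∈))))

-- Matchings in a join

module _ {v : ℕ} (G : Graph v) where

  -- Match bs into rs one vertex at a time, then pair up the 2d vertices left in rs. The permutation
  -- records at once that the endpoints are distinct and that everything is covered.
  crossMatching : ∀ (bs rs : List (Fin v)) d → length rs ≡ length bs + (d + d) →
                  (∀ {x y} → x L.∈ bs → y L.∈ rs → Adj G x y) →
                  (∀ {x y} → x L.∈ rs → y L.∈ rs → x ≢ y → Adj G x y) → Unique rs →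
                  ∃[ P ] (All (uncurry (Adj G)) P × endpoints P ↭ bs ++ rs)
  crossMatching [] [] zero _ _ _ _ = [] , [] , ↭-refl
  -- A single leftover vertex contradicts the even surplus.
  crossMatching [] (x ∷ []) (suc d) eq _ _ _ with trans eq (cong suc (+-suc d d))
  ... | ()
  crossMatching [] (x ∷ y ∷ rs) (suc d) eq cross clique (x∉ ∷ _ ∷ rs!) =
    let P , adj , perm = crossMatching [] rs d (+-cancelˡ-≡ 2 _ _ (trans eq (cong suc (+-suc d d))))
                           (λ ()) (λ x∈ y∈ → clique (there (there x∈)) (there (there y∈))) rs!
    in (x , y) ∷ P , clique (here refl) (there (here refl)) (All.head x∉) ∷ adj , prep x (prep y perm)
  crossMatching (x ∷ bs) (y ∷ rs) d eq cross clique (_ ∷ rs!) =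
    let P , adj , perm = crossMatching bs rs d (+-cancelˡ-≡ 1 _ _ eq)
                           (λ x∈ y∈ → cross (there x∈) (there y∈))
                           (λ x∈ y∈ → clique (there x∈) (there y∈)) rs!
    in (x , y) ∷ P , cross (here refl) (here refl) ∷ adj ,
       prep x (↭-trans (prep y perm) (↭-sym (shift y bs rs)))

  -- A perfect matching of the complement of U, where U collects the vertices already used: ends of
  -- fixed edges and deleted vertices.
  record Completion (U : List (Fin v)) : Set where
    field
      edges : List (Edge v)
      adjacent : All (uncurry (Adj G)) edges
      unique : Unique (endpoints edges)
      disjoint : ∀ {u} → u L.∈ endpoints edges → ¬ (u L.∈ U)
      covering : ∀ {u} → ¬ (u L.∈ U) → u L.∈ endpoints edges

  -- Reserves one edge before the rest is completed; this is how the apex gets matched first.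
  completion-∷ : ∀ {U x y} → Adj G x y → ¬ (x L.∈ U) → ¬ (y L.∈ U) → Completion (x ∷ y ∷ U) →
                 Completion U
  completion-∷ {U} {x} {y} x~y x∉U y∉U C = record
    { edges = (x , y) ∷ edges
    ; adjacent = x~y ∷ adjacent
    ; unique = unique-∷ x∉ (unique-∷ (λ y∈ → disjoint y∈ (there (here refl))) unique)
    ; disjoint = disjoint′
    ; covering = covering′
    }
    where
    open Completion C
    x∉ : ¬ (x L.∈ y ∷ endpoints edges)
    x∉ (here x≡y) = adj⇒≢ G x~y x≡y
    x∉ (there x∈) = disjoint x∈ (here refl)
    disjoint′ : ∀ {u} → u L.∈ x ∷ y ∷ endpoints edges → ¬ (u L.∈ U)
    disjoint′ (here refl) = x∉U
    disjoint′ (there (here refl)) = y∉U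
    disjoint′ (there (there u∈)) u∈U = disjoint u∈ (there (there u∈U))
    covering′ : ∀ {u} → ¬ (u L.∈ U) → u L.∈ x ∷ y ∷ endpoints edges
    covering′ {u} u∉U with u ≟ x | u ≟ y
    ... | yes u≡x | _ = here u≡x
    ... | no _ | yes u≡y = there (here u≡y)
    ... | no u≢x | no u≢y = there (there (covering
      (λ { (here u≡x) → u≢x u≡x ; (there (here u≡y)) → u≢y u≡y ; (there (there u∈U)) → u∉U u∈U })))

  -- The used vertices are x, y, the ends of M and S, so their complement is exactly what M leaves
  -- uncovered in G - x - y - S.
  completion⇒perfect : ∀ {x y S M} → IsMatching G (⊤ ─ ⁅ x ⁆ ─ ⁅ y ⁆ ─ S) M →
    (C : Completion (endpoints ((x , y) ∷ M) ++ elements S)) →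
    IsPerfectMatching G (⊤ ─ ⁅ x ⁆ ─ ⁅ y ⁆ ─ S) (M ++ Completion.edges C)
  completion⇒perfect {x} {y} {S} {M} m C =
      isMatching⁺ G (All.++⁺ (isMatching⇒adj G m) adjacent) sub P! , covers
    where
    open Completion C
    U₀ U : List (Fin v)
    U₀ = endpoints ((x , y) ∷ M)
    U = U₀ ++ elements S
    P! : Unique (endpoints (M ++ edges))
    P! = subst Unique (≡-sym (endpoints-++ M edges))
           (Unique.++⁺ (proj₂ m) unique (λ (u∈M , u∈E) → disjoint u∈E (∈-++⁺ˡ (there (there u∈M)))))
    sub : ∀ {u} → u L.∈ endpoints (M ++ edges) → u ∈ ⊤ ─ ⁅ x ⁆ ─ ⁅ y ⁆ ─ S
    sub u∈ with ∈-++⁻ (endpoints M) (subst (_ L.∈_) (endpoints-++ M edges) u∈)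
    ... | inj₁ u∈M = isMatching⇒⊆ G m u∈M
    ... | inj₂ u∈E = x∈p∧x∉q⇒x∈p─q
      (∈-delete₂⁺ (λ { refl → disjoint u∈E (here refl) }) (λ { refl → disjoint u∈E (there (here refl)) }))
      (λ u∈S → disjoint u∈E (∈-++⁺ʳ U₀ (∈-elements⁺ S u∈S)))
    outside-U : ∀ {u} → u ∈ ⊤ ─ ⁅ x ⁆ ─ ⁅ y ⁆ ─ S → ¬ (u L.∈ endpoints M) → ¬ (u L.∈ U)
    outside-U u∈ u∉M u∈U with ∈-++⁻ U₀ u∈U
    ... | inj₁ (here refl) = proj₁ (∈-delete₂⁻ (p─q⊆p (⊤ ─ ⁅ x ⁆ ─ ⁅ y ⁆) S u∈)) refl
    ... | inj₁ (there (here refl)) = proj₂ (∈-delete₂⁻ (p─q⊆p (⊤ ─ ⁅ x ⁆ ─ ⁅ y ⁆) S u∈)) refl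
    ... | inj₁ (there (there u∈M)) = u∉M u∈M
    ... | inj₂ u∈S = ∈-─⁻ (⊤ ─ ⁅ x ⁆ ─ ⁅ y ⁆) S u∈ (∈-elements⁻ S u∈S)
    covers : ∀ u → u ∈ ⊤ ─ ⁅ x ⁆ ─ ⁅ y ⁆ ─ S → u L.∈ endpoints (M ++ edges)
    covers u u∈ = subst (u L.∈_) (≡-sym (endpoints-++ M edges))
      (∈-++⁺-dec (endpoints M) (λ u∉M → covering (outside-U u∈ u∉M)))

-- An apex joined to b independent vertices, all of which are joined to a clique of r vertices

data Kind : Set where
  apex left right : Kind

Linked : Kind → Kind → Set
Linked apex left = Unit.⊤
Linked left apex = Unit.⊤
Linked left right = Unit.⊤
Linked right left = Unit.⊤
Linked right right = Unit.⊤
Linked _ _ = Empty.⊥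

linked-sym : ∀ k l → Linked k l → Linked l k
linked-sym apex left _ = _
linked-sym left apex _ = _
linked-sym left right _ = _
linked-sym right left _ = _
linked-sym right right _ = _

module _ (b r : ℕ) where

  Vertex : Set
  Vertex = Fin (suc (b + r))

  kind : Vertex → Kind
  kind zero = apex
  kind (suc i) = [ (λ _ → left) , (λ _ → right) ]′ (splitAt b i)

  -- As `Linked right right` holds, the condition `x ≢ y` is what excludes loops in the clique.
  coneGraph : Graph (suc (b + r))
  coneGraph = record
    { Adj = λ x y → x ≢ y × Linked (kind x) (kind y)
    ; sym = λ {x} {y} (x≢y , l) → x≢y ∘ ≡-sym , linked-sym (kind x) (kind y) l
    ; irrefl = λ (x≢x , _) → x≢x refl
    }

  lefts rights : List Vertex
  lefts = tabulate (λ i → suc (i ↑ˡ r))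
  rights = tabulate (λ j → suc (b ↑ʳ j))

  data View : Vertex → Set where
    apex : View zero
    left : ∀ {u} → u L.∈ lefts → View u
    right : ∀ {u} → u L.∈ rights → View u

  view : ∀ u → View u
  view zero = apex
  view (suc i) with splitAt b i | join-splitAt b r i
  ... | inj₁ j | refl = left (∈-tabulate⁺ j)
  ... | inj₂ j | refl = right (∈-tabulate⁺ j)

  kind-left : ∀ {u} → u L.∈ lefts → kind u ≡ left
  kind-left u∈ with ∈-tabulate⁻ u∈
  ... | i , refl rewrite splitAt-↑ˡ b i r = refl

  kind-right : ∀ {u} → u L.∈ rights → kind u ≡ right
  kind-right u∈ with ∈-tabulate⁻ u∈
  ... | j , refl rewrite splitAt-↑ʳ b r j = refl

  lefts-unique : Unique lefts
  lefts-unique = Unique.tabulate⁺ (λ eq → ↑ˡ-injective r _ _ (suc-injective eq))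

  rights-unique : Unique rights
  rights-unique = Unique.tabulate⁺ (λ eq → ↑ʳ-injective b _ _ (suc-injective eq))

  adj-by-kind : ∀ {x y k l} → x ≢ y → kind x ≡ k → kind y ≡ l → Linked k l → Adj coneGraph x y
  adj-by-kind x≢y refl refl linked = x≢y , linked

  different-kinds : ∀ {x y k l} → kind x ≡ k → kind y ≡ l → k ≢ l → x ≢ y
  different-kinds refl refl k≢l refl = k≢l refl

  adj-apex-left : ∀ {x} → x L.∈ lefts → Adj coneGraph zero x
  adj-apex-left x∈ = adj-by-kind (different-kinds refl (kind-left x∈) (λ ())) refl (kind-left x∈) _

  adj-left-right : ∀ {x y} → x L.∈ lefts → y L.∈ rights → Adj coneGraph x y
  adj-left-right x∈ y∈ =
    adj-by-kind (different-kinds (kind-left x∈) (kind-right y∈) (λ ())) (kind-left x∈) (kind-right y∈) _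

  adj-right-right : ∀ {x y} → x L.∈ rights → y L.∈ rights → x ≢ y → Adj coneGraph x y
  adj-right-right x∈ y∈ x≢y = adj-by-kind x≢y (kind-right x∈) (kind-right y∈) _

  apex-neighbour : ∀ {x} → Adj coneGraph zero x → x L.∈ lefts
  apex-neighbour {x} (x≢ , l) with view x
  ... | apex = contradiction refl x≢
  ... | left x∈ = x∈
  ... | right x∈ with subst (Linked apex) (kind-right x∈) l
  ... | ()

  -- For an edge inside the clique the value y is only a default; this is harmless, as the map
  -- serves to bound the number of covered independent vertices from above.
  leftEnd : Edge (suc (b + r)) → Vertex
  leftEnd (x , y) with kind x
  ... | left = x
  ... | _ = y

  -- No two independent vertices are linked, so an independent end of an edge is the end that
  -- `leftEnd` selects.
  ∈-leftEnd : ∀ {M u} → All (uncurry (Adj coneGraph)) M → u L.∈ endpoints M → kind u ≡ left →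
              u L.∈ map leftEnd M
  ∈-leftEnd {(x , y) ∷ M} _ (here refl) eq with kind x
  ∈-leftEnd {(x , y) ∷ M} _ (here refl) refl | left = here refl
  ∈-leftEnd {(x , y) ∷ M} ((_ , l) ∷ _) (there (here refl)) eq with kind x
  ... | apex = here refl
  ... | right = here refl
  ... | left with subst (Linked left) eq l
  ... | ()
  ∈-leftEnd (_ ∷ as) (there (there u∈)) eq = there (∈-leftEnd as u∈ eq)

  -- Each edge has at most one end among the independent vertices.
  lefts-uncovered : ∀ N (T : List Vertex) → All (uncurry (Adj coneGraph)) N →
                    length T + length N < b →
                    ¬ (∀ {u} → u L.∈ lefts → u L.∈ endpoints N ++ T)
  lefts-uncovered N T adj small covered = <⇒≱ small (begin
    b                                 ≡⟨ length-tabulate _ ⟨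
    length lefts                      ≤⟨ unique-⊆⇒length≤ lefts-unique sub ⟩
    length (T ++ map leftEnd N)       ≡⟨ length-++ T ⟩
    length T + length (map leftEnd N) ≡⟨ cong (length T +_) (length-map leftEnd N) ⟩
    length T + length N               ∎)
    where
    open ≤-Reasoning
    sub : ∀ {u} → u L.∈ lefts → u L.∈ T ++ map leftEnd N
    sub u∈ with ∈-++⁻ (endpoints N) (covered u∈)
    ... | inj₁ u∈N = ∈-++⁺ʳ T (∈-leftEnd adj u∈N (kind-left u∈))
    ... | inj₂ u∈T = ∈-++⁺ˡ u∈T

  -- Completing a partial matching of the cone graph.

  EvenComplement : List Vertex → Set
  EvenComplement U = ∀ m → m + length U ≡ suc (b + r) → 2 ∣ m

  -- With the apex used, the free independent vertices go into the clique. The bound on r leaves at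
  -- least as many free clique vertices, and parity makes their surplus even, so it can be paired
  -- up.
  complete-without-apex : ∀ {U} → zero L.∈ U → Unique U → b + length U ≤ r → EvenComplement U →
                          Completion coneGraph U
  complete-without-apex {U} 0∈U U! large even =
    let d , eq = excess Bs≤Rs (even _ (trans (cong (_+ length U) (≡-sym (length-++ Bs)))
                                             (length-complement BR! U! avoid cover)))
        P , adj , perm = crossMatching coneGraph Bs Rs d eq cross clique Rs!
    in record
      { edges = P
      ; adjacent = adj
      ; unique = Unique-resp-↭ (setoid _) (↭⇒↭ₛ (↭-sym perm)) BR!
      ; disjoint = λ u∈ → avoid (∈-resp-↭ perm u∈)
      ; covering = λ u∉ → ∈-resp-↭ (↭-sym perm) (cover u∉)
      }
    where
    Bs = lefts ∖ U
    Rs = rights ∖ U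
    Rs! = unique-∖ U rights-unique
    Bs≤Rs : length Bs ≤ length Rs
    Bs≤Rs = +-cancelˡ-≤ (length U) _ _ (begin
      length U + length Bs    ≤⟨ +-monoʳ-≤ (length U) (length-filter _ lefts) ⟩
      length U + length lefts ≡⟨ cong (length U +_) (length-tabulate {n = b} _) ⟩
      length U + b            ≡⟨ +-comm (length U) b ⟩
      b + length U            ≤⟨ large ⟩
      r                       ≡⟨ length-tabulate {n = r} _ ⟨
      length rights           ≤⟨ length-∖ U rights-unique ⟩
      length U + length Rs    ∎)
      where open ≤-Reasoning
    cross : ∀ {x y} → x L.∈ Bs → y L.∈ Rs → Adj coneGraph x y
    cross x∈ y∈ = adj-left-right (proj₁ (∈-∖⁻ lefts U x∈)) (proj₁ (∈-∖⁻ rights U y∈))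
    clique : ∀ {x y} → x L.∈ Rs → y L.∈ Rs → x ≢ y → Adj coneGraph x y
    clique x∈ y∈ = adj-right-right (proj₁ (∈-∖⁻ rights U x∈)) (proj₁ (∈-∖⁻ rights U y∈))
    BR! : Unique (Bs ++ Rs)
    BR! = Unique.++⁺ (unique-∖ U lefts-unique) Rs! (λ (x∈ , y∈) → proj₁ (cross x∈ y∈) refl)
    avoid : ∀ {u} → u L.∈ Bs ++ Rs → ¬ (u L.∈ U)
    avoid u∈ with ∈-++⁻ Bs u∈
    ... | inj₁ u∈B = proj₂ (∈-∖⁻ lefts U u∈B)
    ... | inj₂ u∈R = proj₂ (∈-∖⁻ rights U u∈R)
    cover : ∀ {u} → ¬ (u L.∈ U) → u L.∈ Bs ++ Rs
    cover {u} u∉U with view u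
    ... | apex = contradiction 0∈U u∉U
    ... | left u∈ = ∈-++⁺ˡ (∈-∖⁺ u∈ u∉U)
    ... | right u∈ = ∈-++⁺ʳ Bs (∈-∖⁺ u∈ u∉U)

  -- A free apex is first matched to a free independent vertex, which exists because U misses one.
  -- The summand 2 in the bound pays for these two vertices.
  complete : ∀ {U} → Unique U → ¬ (∀ {u} → u L.∈ lefts → u L.∈ U) → b + (2 + length U) ≤ r →
             EvenComplement U → Completion coneGraph U
  complete {U} U! lefts⊈U large even with zero ∈ˡ? U
  ... | yes 0∈U = complete-without-apex 0∈U U!
                    (≤-trans (+-monoʳ-≤ b (m≤n+m (length U) 2)) large) even
  ... | no 0∉U with lefts ∖ U in eq
  ...   | [] = Empty.⊥-elim (lefts⊈U lefts⊆U)
    where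
    lefts⊆U : ∀ {u} → u L.∈ lefts → u L.∈ U
    lefts⊆U {u} u∈ with u ∈ˡ? U
    ... | yes u∈U = u∈U
    ... | no u∉U with subst (u L.∈_) eq (∈-∖⁺ u∈ u∉U)
    ... | ()
  -- Using up two more vertices preserves the parity of the complement.
  ...   | x ∷ _ = completion-∷ coneGraph 0~x 0∉U x∉U
    (complete-without-apex (here refl) U′! large
      (λ m m+≡ → ∣m+n∣m⇒∣n (even (2 + m) (trans (+-suc-suc m (length U)) m+≡)) ∣-refl))
    where
    x∈∖ : x L.∈ lefts ∖ U
    x∈∖ = subst (x L.∈_) (≡-sym eq) (here refl)
    x∉U = proj₂ (∈-∖⁻ lefts U x∈∖)
    0~x = adj-apex-left (proj₁ (∈-∖⁻ lefts U x∈∖))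
    U′! : Unique (zero ∷ x ∷ U)
    U′! = unique-∷ (λ { (here 0≡x) → proj₁ 0~x 0≡x ; (there 0∈) → 0∉U 0∈ }) (unique-∷ x∉U U!)

  -- The edge xy and the given matching form at most k + 1 edges; with n deleted vertices they meet
  -- at most n + k + 1 < b independent vertices, so one is left for the apex. Up to 2(k + 1) + n
  -- vertices are used, whence the bound on r.
  edgeDeletedExtendable : ∀ n k h → n + suc k < b → b + (2 + (2 * suc k + n)) ≤ r →
                          suc (b + r) ≡ n + 2 * h → EdgeDeletedExtendable coneGraph n k
  edgeDeletedExtendable n k h small large size x y x~y = bound , even , λ S S⊆W ∣S∣≡n →
      exists S S⊆W ∣S∣≡n , λ M (m , len) → let P , perfect , ext , _ = extend S S⊆W ∣S∣≡n M m (≤-reflexive len)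
                                       in P , perfect , ext
    where
    W = ⊤ ─ ⁅ x ⁆ ─ ⁅ y ⁆
    ∣W∣+2 : ∣ W ∣ + 2 ≡ suc (b + r)
    ∣W∣+2 = ∣delete₂∣ (proj₁ x~y)

    wide : n + 2 * k + 2 + 2 ≤ suc (b + r)
    wide = begin
      n + 2 * k + 2 + 2         ≡⟨ regroup n k ⟩
      2 + (2 * suc k + n)       ≤⟨ m≤n+m _ b ⟩
      b + (2 + (2 * suc k + n)) ≤⟨ large ⟩
      r                         ≤⟨ m≤n+m r (suc b) ⟩
      suc (b + r)               ∎
      where
      open ≤-Reasoning
      regroup : ∀ n k → n + 2 * k + 2 + 2 ≡ 2 + (2 * suc k + n)
      regroup = solve-∀

    bound : n + 2 * k + 2 ≤ ∣ W ∣
    bound = +-cancelʳ-≤ 2 _ _ (≤-trans wide (≤-reflexive (≡-sym ∣W∣+2)))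

    n≤∣W∣ : n ≤ ∣ W ∣
    n≤∣W∣ = ≤-trans (≤-trans (m≤m+n n (2 * k)) (m≤m+n (n + 2 * k) 2)) bound

    even : 2 ∣ (∣ W ∣ ∸ n)
    even = ∣m+n∣m⇒∣n (subst (2 ∣_) (≡-sym eq) (m∣m*n h)) ∣-refl
      where
      regroup : ∀ n w → n + (2 + w) ≡ n + w + 2
      regroup = solve-∀
      eq : 2 + (∣ W ∣ ∸ n) ≡ 2 * h
      eq = +-cancelˡ-≡ n _ _ (trans (regroup n (∣ W ∣ ∸ n))
             (trans (cong (_+ 2) (m+[n∸m]≡n n≤∣W∣)) (trans ∣W∣+2 size)))

    -- Allowing fewer than k edges lets the empty matching be extended as well, which supplies the
    -- required k-matching. The final equation counts the vertices: those covered by P, then x, y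
    -- and S.
    extend : ∀ S → S ⊆ W → ∣ S ∣ ≡ n → ∀ M → IsMatching coneGraph (W ─ S) M → length M ≤ k →
             ∃[ P ] (IsPerfectMatching coneGraph (W ─ S) P × Extends M P ×
                     2 * length P + (2 + n) ≡ suc (b + r))
    extend S S⊆W ∣S∣≡n M m M≤k =
        M ++ edges , completion⇒perfect coneGraph m completion , extends-++ˡ M edges , count
      where
      x∉S : x ∉ S
      x∉S x∈S = proj₁ (∈-delete₂⁻ (S⊆W x∈S)) refl
      y∉S : y ∉ S
      y∉S y∈S = proj₂ (∈-delete₂⁻ (S⊆W y∈S)) refl
      N = (x , y) ∷ M
      N-matching = isMatching-∷ coneGraph {S = S} x~y x∉S y∉S m
      U = endpoints N ++ elements S
      ∣elements∣ : length (elements S) ≡ n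
      ∣elements∣ = trans (length-elements S) ∣S∣≡n
      U! : Unique U
      U! = Unique.++⁺ (proj₂ N-matching) (unique-elements S)
             (λ (u∈N , u∈S) → ∈-─⁻ ⊤ S (isMatching⇒⊆ coneGraph N-matching u∈N) (∈-elements⁻ S u∈S))
      ∣U∣ : length U ≡ 2 * length N + n
      ∣U∣ = trans (length-++ (endpoints N)) (cong₂ _+_ (length-endpoints N) ∣elements∣)
      N≤ : length N ≤ suc k
      N≤ = s≤s M≤k
      evenComplement : EvenComplement U
      evenComplement μ eq = ∣m+n∣m⇒∣n (subst (2 ∣_) (≡-sym eq′) (m∣m*n h)) (m∣m*n (length N))
        where
        regroup : ∀ n l μ → n + (2 * l + μ) ≡ μ + (2 * l + n)
        regroup = solve-∀
        eq′ : 2 * length N + μ ≡ 2 * h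
        eq′ = +-cancelˡ-≡ n _ _ (trans (regroup n (length N) μ)
                (trans (cong (μ +_) (≡-sym ∣U∣)) (trans eq size)))
      completion = complete U!
        (lefts-uncovered N (elements S) (isMatching⇒adj coneGraph N-matching)
          (≤-<-trans (+-mono-≤ (≤-reflexive ∣elements∣) N≤) small))
        (≤-trans (+-monoʳ-≤ b (+-monoʳ-≤ 2 (≤-trans (≤-reflexive ∣U∣) (+-monoˡ-≤ n (*-monoʳ-≤ 2 N≤))))) large)
        evenComplement
      open Completion completion
      count : 2 * length (M ++ edges) + (2 + n) ≡ suc (b + r)
      count = trans (trans (cong (λ l → 2 * l + (2 + n)) (length-++ M)) (trans (regroup _ _ n)
        (cong₂ _+_ (≡-sym (length-endpoints edges)) (≡-sym ∣U∣))))
        (length-complement unique U! disjoint covering)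
        where
        regroup : ∀ p q n → 2 * (p + q) + (2 + n) ≡ 2 * q + (2 * suc p + n)
        regroup = solve-∀

    -- By the vertex count the perfect matching has at least k edges, so its first k edges can be
    -- kept.
    kMatching : ∀ {S} → ∃[ P ] (IsPerfectMatching coneGraph (W ─ S) P × Extends [] P ×
                               2 * length P + (2 + n) ≡ suc (b + r)) →
                ∃[ M ] IsKMatching coneGraph (W ─ S) k M
    kMatching (P , (matching , _) , _ , count) =
      take k P , isMatching-take coneGraph k matching , trans (length-take k P) (m≤n⇒m⊓n≡m k≤∣P∣)
      where
      regroup : ∀ n k → 2 * k + (2 + n) + 2 ≡ n + 2 * k + 2 + 2
      regroup = solve-∀
      k≤∣P∣ : k ≤ length P
      k≤∣P∣ = *-cancelˡ-≤ 2 (+-cancelʳ-≤ (2 + n) _ _ (≤-trans (m≤m+n _ 2)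
        (≤-trans (≤-reflexive (regroup n k)) (≤-trans wide (≤-reflexive (≡-sym count))))))

    exists : ∀ S → S ⊆ W → ∣ S ∣ ≡ n → ∃[ M ] IsKMatching coneGraph (W ─ S) k M
    exists S S⊆W ∣S∣≡n = kMatching (extend S S⊆W ∣S∣≡n [] ([] , []) z≤n)

  -- Delete s of the b neighbours of the apex and match the other j into the clique: the apex
  -- is left without a partner.
  ¬extendable : ∀ s j → s + j ≡ b → j ≤ r → ¬ GExtendable coneGraph s j
  ¬extendable s j s+j≡b j≤r (_ , _ , ext) = 0∉M (joins⇒∈ (joins-sym y–0∈M))
    where
    deleted = take s lefts
    matched = drop s lefts
    partners = take j rights
    S = fromList deleted
    ∣lefts∣ : length lefts ≡ b
    ∣lefts∣ = length-tabulate _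
    s≤b : s ≤ b
    s≤b = ≤-trans (m≤m+n s j) (≤-reflexive s+j≡b)
    ∣S∣≡s : ∣ S ∣ ≡ s
    ∣S∣≡s = trans (∣fromList∣ (Unique.take⁺ s lefts-unique))
              (trans (length-take s lefts) (m≤n⇒m⊓n≡m (≤-trans s≤b (≤-reflexive (≡-sym ∣lefts∣)))))
    ∣matched∣ : length matched ≡ j
    ∣matched∣ = trans (length-drop s lefts)
      (trans (cong (_∸ s) (trans ∣lefts∣ (≡-sym s+j≡b))) (m+n∸m≡n s j))
    ∣partners∣ : length partners ≡ j
    ∣partners∣ = trans (length-take j rights)
      (m≤n⇒m⊓n≡m (≤-trans j≤r (≤-reflexive (≡-sym (length-tabulate {n = r} _)))))
    -- Surplus 0: as many clique vertices as undeleted independent ones, so all edges run across.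
    crossing = crossMatching coneGraph matched partners 0
      (trans ∣partners∣ (trans (≡-sym ∣matched∣) (≡-sym (+-identityʳ _))))
      (λ x∈ y∈ → adj-left-right (∈-drop s x∈) (∈-take j y∈))
      (λ x∈ y∈ → adj-right-right (∈-take j x∈) (∈-take j y∈))
      (Unique.take⁺ j rights-unique)
    M = proj₁ crossing
    perm : endpoints M ↭ matched ++ partners
    perm = proj₂ (proj₂ crossing)
    left≢right : ∀ {x y} → x L.∈ lefts → y L.∈ rights → x ≢ y
    left≢right x∈ y∈ = proj₁ (adj-left-right x∈ y∈)
    sub : ∀ {u} → u L.∈ endpoints M → u ∈ ⊤ ─ S
    sub {u} u∈ = x∈p∧x∉q⇒x∈p─q ∈⊤ (λ u∈S → kept (∈-++⁻ matched (∈-resp-↭ perm u∈)) (∈-fromList⁻ deleted u∈S))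
      where
      kept : (u L.∈ matched) ⊎ (u L.∈ partners) → ¬ (u L.∈ deleted)
      kept (inj₁ u∈m) u∈d =
        ∈-++-disjoint (subst Unique (≡-sym (take++drop≡id s lefts)) lefts-unique) u∈d u∈m
      kept (inj₂ u∈p) u∈d = left≢right (∈-take s u∈d) (∈-take j u∈p) refl
    M! : Unique (endpoints M)
    M! = Unique-resp-↭ (setoid _) (↭⇒↭ₛ (↭-sym perm)) (Unique.++⁺ (Unique.drop⁺ s lefts-unique)
           (Unique.take⁺ j rights-unique) (λ (x∈ , y∈) → left≢right (∈-drop s x∈) (∈-take j y∈) refl))
    ∣M∣≡j : length M ≡ j
    ∣M∣≡j = *-cancelˡ-≡ _ _ 2 (trans (≡-sym (length-endpoints M)) (trans (↭-length perm)
      (trans (length-++ matched) (cong₂ _+_ ∣matched∣ (trans ∣partners∣ (≡-sym (+-identityʳ j)))))))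
    extension = proj₂ (ext S (λ _ → ∈⊤) ∣S∣≡s) M (isMatching⁺ coneGraph (proj₁ (proj₂ crossing)) sub M! , ∣M∣≡j)
    M′ = proj₁ extension
    M′-perfect = proj₁ (proj₂ extension)
    M⊆M′ = proj₂ (proj₂ extension)
    0∉lefts : ¬ (zero L.∈ lefts)
    0∉lefts 0∈ = proj₁ (adj-apex-left 0∈) refl
    0∉M : ¬ (zero L.∈ endpoints M)
    0∉M 0∈ with ∈-++⁻ matched (∈-resp-↭ perm 0∈)
    ... | inj₁ 0∈m = 0∉lefts (∈-drop s 0∈m)
    ... | inj₂ 0∈p with kind-right (∈-take j 0∈p)
    ... | ()
    0∈⊤─S : zero ∈ ⊤ ─ S
    0∈⊤─S = x∈p∧x∉q⇒x∈p─q ∈⊤ (λ 0∈ → 0∉lefts (∈-take s (∈-fromList⁻ deleted 0∈)))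
    -- The apex survives the deletion, so a perfect extension gives it a partner y. This y is
    -- independent and not deleted, hence already covered by M.
    apexPartner = ∈⇒joins M′ (proj₂ M′-perfect zero 0∈⊤─S)
    y = proj₁ apexPartner
    0–y = proj₂ apexPartner
    y∈lefts : y L.∈ lefts
    y∈lefts = apex-neighbour (joins⇒adj coneGraph (isMatching⇒adj coneGraph (proj₁ M′-perfect)) 0–y)
    y∉deleted : ¬ (y L.∈ deleted)
    y∉deleted y∈ = ∈-─⁻ ⊤ S (isMatching⇒⊆ coneGraph (proj₁ M′-perfect) (joins⇒∈ (joins-sym 0–y)))
                     (∈-fromList⁺ y∈)
    y∈M : y L.∈ endpoints M
    y∈M = [ (λ y∈d → contradiction y∈d y∉deleted) , (λ y∈m → ∈-resp-↭ (↭-sym perm) (∈-++⁺ˡ y∈m)) ]′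
            (∈-++⁻ deleted (subst (y L.∈_) (≡-sym (take++drop≡id s lefts)) y∈lefts))
    -- The partner of y in M stays its partner in `M′`, where it is the apex; but M does not meet
    -- the apex.
    y–0∈M : Joins M y zero
    y–0∈M = let z , y–z = ∈⇒joins M y∈M in
      subst (Joins M y)
        (joins-functional (proj₂ (proj₁ M′-perfect)) (joins-extends M⊆M′ y–z) (joins-sym 0–y)) y–z

theorem2 : (∀ (n k v : ℕ) (G : Graph v) → HasEdge G → EdgeDeletedExtendable G n k →
    GExtendable G n (suc k))
    × (∀ (n k : ℕ) → Σ ℕ λ v → Σ (Graph v) λ G →
    HasEdge G × EdgeDeletedExtendable G n k × ¬ GExtendable G n (k + 2))
    × (∀ (n k : ℕ) → Σ ℕ λ v → Σ (Graph v) λ G →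
    HasEdge G × EdgeDeletedExtendable G n k × ¬ GExtendable G (n + 2) k)
theorem2 =
  (λ n k v G edge deleted → gExtendable-suc G deleted edge) ,
  (λ n k → _ , coneGraph (B n k) (R n k) , hasEdge n k , deletedExtendable n k ,
    ¬extendable (B n k) (R n k) n (k + 2) (assoc₁ n k) (enough n k)) ,
  (λ n k → _ , coneGraph (B n k) (R n k) , hasEdge n k , deletedExtendable n k ,
    ¬extendable (B n k) (R n k) (n + 2) k (assoc₂ n k) (≤-trans (m≤m+n k 2) (enough n k)))
  where
  B R : ℕ → ℕ → ℕ
  -- The least b with n + k + 1 < b; it equals both n + (k + 2) and (n + 2) + k, so one graph
  -- refutes both statements.
  B n k = 2 + (n + k)
  -- The clique must exceed b by at least n + 2k + 4. One more vertex makes the order minus n even,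
  -- namely 2(n + 2k + 5).
  R n k = B n k + (n + 2 * k + 5)
  assoc₁ : ∀ n k → n + (k + 2) ≡ 2 + (n + k)
  assoc₁ = solve-∀
  assoc₂ : ∀ n k → n + 2 + k ≡ 2 + (n + k)
  assoc₂ = solve-∀
  enough : ∀ n k → k + 2 ≤ R n k
  enough n k = ≤-trans (≤-trans (m≤n+m (k + 2) n) (≤-reflexive (assoc₁ n k))) (m≤m+n (B n k) _)
  hasEdge : ∀ n k → HasEdge (coneGraph (B n k) (R n k))
  hasEdge n k = zero , _ , adj-apex-left (B n k) (R n k) (here refl)
  deletedExtendable : ∀ n k → EdgeDeletedExtendable (coneGraph (B n k) (R n k)) n k
  deletedExtendable n k = edgeDeletedExtendable (B n k) (R n k) n k (n + 2 * k + 5)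
    (≤-reflexive (small n k)) (+-monoʳ-≤ (B n k) (≤-trans (m≤m+n _ 1) (≤-reflexive (large n k)))) (size n k)
    where
    small : ∀ n k → suc (n + suc k) ≡ 2 + (n + k)
    small = solve-∀
    large : ∀ n k → 2 + (2 * suc k + n) + 1 ≡ n + 2 * k + 5
    large = solve-∀
    size : ∀ n k → suc (2 + (n + k) + (2 + (n + k) + (n + 2 * k + 5))) ≡ n + 2 * (n + 2 * k + 5)
    size = solve-∀
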